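{- For any fixed integers $k, r, p$ with $k \ge r \ge 1$ and $p \ge r$, the limit $$l(k,r,p) = \lim_{n\to\infty} \frac{L(n,k,r,p)}{\binom{n}{r}}$$ exists (as a finite real number).
   Context: $L(n,k,r,p)$ denotes the minimum size of an $(n,k,r,p)$-lottery system, where an $(n,k,r,p)$-lottery system is a system (set) of $k$-element subsets ("edges") of a set $V$ with $|V|=n$ such that for every $p$-element subset $P \subseteq V$ there is an edge $K$ with $|K \cap P| \ge r$. (This is considered for $n \ge \max(k,p)$, where the system of all $k$-element subsets qualifies.) -}

module Defs where

open import Data.Bool.Properties using () renaming (_≟_ to _≟ᵇ_)
open import Data.Fin.Subset using (Subset; inside; outside; ⊥; ∣_∣; _∩_)
open import Data.Fin.Subset.Properties using (anySubset?; ∣⊥∣≡0; ∣p∣≤n)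
open import Data.Integer using (+_)
open import Data.List using (List; []; _∷_; _++_; map; filter; length)
open import Data.List.Membership.Propositional using (_∈_; lose)
open import Data.List.Membership.Propositional.Properties
  using (∈-map⁺; ∈-map⁻; ∈-++⁺ˡ; ∈-++⁺ʳ; ∈-filter⁺)
open import Data.List.Relation.Unary.All using (All; []; all?)
open import Data.List.Relation.Unary.All.Properties using (all-filter)
open import Data.List.Relation.Unary.AllPairs using ([]; _∷_)
open import Data.List.Relation.Unary.Any using (Any; here; any?)
open import Data.List.Relation.Unary.Unique.Propositional using (Unique)
import Data.List.Relation.Unary.Unique.DecPropositional as DecUnique
import Data.List.Relation.Unary.Unique.Propositional.Properties as Unique
open import Data.Nat
  using (ℕ; zero; suc; _≤_; _<_; z≤n; s≤s; s≤s⁻¹; _≤?_; _⊔_; NonZero; >-nonZero)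
open import Data.Nat.Combinatorics using (_C_; nCk≡nC[n∸k]; nCn≡1; nCk+nC[k+1]≡[n+1]C[k+1])
open import Data.Nat.Properties
  using (≤-refl; ≤-trans; ≤-reflexive; m≤m+n; m≤m⊔n; m≤n⇒m<n∨m≡n; _≟_)
open import Data.Product using (∃; ∃-syntax; _×_; _,_; proj₁; proj₂)
open import Data.Rational using (ℚ; 0ℚ; _/_) renaming (_+_ to _+ℚ_; _-_ to _-ℚ_; _<_ to _<ℚ_)
open import Data.Sum using (_⊎_; inj₁; inj₂)
open import Data.Vec using ([]; _∷_)
open import Data.Vec.Properties using (≡-dec)
open import Function using (_∘_; _⇔_)
open import Relation.Binary.PropositionalEquality using (_≡_; refl; sym; trans; cong; subst)
open import Relation.Nullary using (¬_; Dec; yes; no; contradiction)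
open import Relation.Nullary.Decidable using (map′; ¬?; _×-dec_; _⊎-dec_; decidable-stable)
open import Relation.Unary using (Decidable)

-- The vertex set V is Fin n; a system is a duplicate-free list of edges.

IsLotterySystem : (n k r p : ℕ) → List (Subset n) → Set
IsLotterySystem n k r p 𝓚 =
    Unique 𝓚
  × All (λ K → ∣ K ∣ ≡ k) 𝓚
  × (∀ (P : Subset n) → ∣ P ∣ ≡ p → Any (λ K → r ≤ ∣ K ∩ P ∣) 𝓚)

HasSystemOfSize : (n k r p m : ℕ) → Set
HasSystemOfSize n k r p m = ∃[ 𝓚 ] length 𝓚 ≡ m × IsLotterySystem n k r p 𝓚

IsLeast : (ℕ → Set) → ℕ → Set
IsLeast Q m = Q m × (∀ j → Q j → m ≤ j)

private
  isLotterySystem? : ∀ n k r p → Decidable (IsLotterySystem n k r p)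
  isLotterySystem? n k r p 𝓚 =
    DecUnique.unique? (≡-dec _≟ᵇ_) 𝓚 ×-dec all? (λ K → ∣ K ∣ ≟ k) 𝓚 ×-dec covers?
    where
    hit? : (P : Subset n) → Dec (Any (λ K → r ≤ ∣ K ∩ P ∣) 𝓚)
    hit? P = any? (λ K → r ≤? ∣ K ∩ P ∣) 𝓚

    covers? : Dec (∀ P → ∣ P ∣ ≡ p → Any (λ K → r ≤ ∣ K ∩ P ∣) 𝓚)
    covers? = map′
      (λ none P ∣P∣≡p → decidable-stable (hit? P) λ miss → none (P , ∣P∣≡p , miss))
      (λ covers (P , ∣P∣≡p , miss) → miss (covers P ∣P∣≡p))
      (¬? (anySubset? λ P → (∣ P ∣ ≟ p) ×-dec ¬? (hit? P)))

  anyListOfLength? : ∀ {n} {Q : List (Subset n) → Set} → Decidable Q →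
                     ∀ m → Dec (∃[ 𝓚 ] length 𝓚 ≡ m × Q 𝓚)
  anyListOfLength? Q? zero =
    map′ (λ q → [] , refl , q) (λ { ([] , _ , q) → q }) (Q? [])
  anyListOfLength? Q? (suc m) =
    map′ (λ (K , 𝓚 , eq , q) → K ∷ 𝓚 , cong suc eq , q)
         (λ { (K ∷ 𝓚 , refl , q) → K , 𝓚 , refl , q })
         (anySubset? λ K → anyListOfLength? (Q? ∘ (K ∷_)) m)

  least : ∀ {Q : ℕ → Set} → Decidable Q → ∀ {m} → Q m → ∃ (IsLeast Q)
  least Q? {zero}  q = zero , q , λ _ _ → z≤n
  least {Q} Q? {suc m} q with Q? zero
  ... | yes q₀ = zero , q₀ , λ _ _ → z≤n
  ... | no ¬q₀ with least (Q? ∘ suc) {m} q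
  ...   | l , ql , min = suc l , ql , λ { zero q₀ → contradiction q₀ ¬q₀
                                        ; (suc j) qj → s≤s (min j qj) }

  allSubsets : ∀ n → List (Subset n)
  allSubsets zero    = [] ∷ []
  allSubsets (suc n) = map (inside ∷_) (allSubsets n) ++ map (outside ∷_) (allSubsets n)

  ∈-allSubsets : ∀ {n} (K : Subset n) → K ∈ allSubsets n
  ∈-allSubsets []            = here refl
  ∈-allSubsets (inside ∷ K)  = ∈-++⁺ˡ (∈-map⁺ (inside ∷_) (∈-allSubsets K))
  ∈-allSubsets (outside ∷ K) = ∈-++⁺ʳ _ (∈-map⁺ (outside ∷_) (∈-allSubsets K))

  allSubsets-unique : ∀ n → Unique (allSubsets n)
  allSubsets-unique zero    = [] ∷ []
  allSubsets-unique (suc n) = Unique.++⁺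
    (Unique.map⁺ (λ { refl → refl }) (allSubsets-unique n))
    (Unique.map⁺ (λ { refl → refl }) (allSubsets-unique n))
    disjoint
    where
    disjoint : ∀ {K} → ¬ (K ∈ map (inside ∷_) (allSubsets n) × K ∈ map (outside ∷_) (allSubsets n))
    disjoint (i , o) with ∈-map⁻ (inside ∷_) i | ∈-map⁻ (outside ∷_) o
    ... | _ , _ , refl | _ , _ , ()

  meetingEdge : ∀ {n} k r (P : Subset n) → r ≤ k → k ≤ n → r ≤ ∣ P ∣ →
                ∃[ K ] ∣ K ∣ ≡ k × r ≤ ∣ K ∩ P ∣
  meetingEdge {n} zero r P z≤n k≤n r≤P = ⊥ , ∣⊥∣≡0 n , z≤n
  meetingEdge (suc k) r (inside ∷ P) r≤k (s≤s k≤n) r≤P with r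
  ... | zero  = let K , eq , _ = meetingEdge k zero P z≤n k≤n z≤n
                in  inside ∷ K , cong suc eq , z≤n
  ... | suc r = let K , eq , hit = meetingEdge k r P (s≤s⁻¹ r≤k) k≤n (s≤s⁻¹ r≤P)
                in  inside ∷ K , cong suc eq , s≤s hit
  meetingEdge (suc k) r (outside ∷ P) r≤k (s≤s k≤n) r≤P with m≤n⇒m<n∨m≡n k≤n
  ... | inj₁ k<n = let K , eq , hit = meetingEdge (suc k) r P r≤k k<n r≤P
                   in  outside ∷ K , eq , hit
  ... | inj₂ refl = let K , eq , hit = meetingEdge k r P (≤-trans r≤P (∣p∣≤n P)) k≤n r≤P
                    in  inside ∷ K , cong suc eq , hit

  completeSystem : ∀ n k r p → r ≤ k → r ≤ p → k ⊔ p ≤ n →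
                   ∃[ 𝓚 ] IsLotterySystem n k r p 𝓚
  completeSystem n k r p r≤k r≤p k⊔p≤n =
      filter size? (allSubsets n)
    , Unique.filter⁺ size? (allSubsets-unique n)
    , all-filter size? (allSubsets n)
    , λ P ∣P∣≡p →
        let K , eq , hit = meetingEdge k r P r≤k (≤-trans (m≤m⊔n k p) k⊔p≤n)
                             (≤-trans r≤p (≤-reflexive (sym ∣P∣≡p)))
        in  lose (∈-filter⁺ size? (∈-allSubsets K) eq) hit
    where
    size? : Decidable (λ (K : Subset n) → ∣ K ∣ ≡ k)
    size? K = ∣ K ∣ ≟ k

leastSystemSize : ∀ n k r p → r ≤ k → r ≤ p → k ⊔ p ≤ n →
                  ∃ (IsLeast (HasSystemOfSize n k r p))
leastSystemSize n k r p r≤k r≤p k⊔p≤n =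
  let 𝓚 , sys = completeSystem n k r p r≤k r≤p k⊔p≤n
  in  least (anyListOfLength? (isLotterySystem? n k r p)) (𝓚 , refl , sys)

-- L(n,k,r,p).  The three inequalities ensure that a lottery system exists.

L : ∀ n k r p → r ≤ k → r ≤ p → k ⊔ p ≤ n → ℕ
L n k r p r≤k r≤p k⊔p≤n = proj₁ (leastSystemSize n k r p r≤k r≤p k⊔p≤n)

nCr-nonZero : ∀ n r → r ≤ n → NonZero (n C r)
nCr-nonZero n r r≤n = >-nonZero (positive n r r≤n)
  where
  positive : ∀ n r → r ≤ n → 0 < n C r
  positive n zero z≤n =
    ≤-reflexive (sym (trans (nCk≡nC[n∸k] {zero} {n} z≤n) (nCn≡1 n)))
  positive (suc n) (suc r) (s≤s r≤n) =
    subst (0 <_) (nCk+nC[k+1]≡[n+1]C[k+1] n r) (≤-trans (positive n r r≤n) (m≤m+n _ _))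

lotteryRatio : ∀ k r p → r ≤ k → r ≤ p → ∀ n → k ⊔ p ≤ n → ℚ
lotteryRatio k r p r≤k r≤p n k⊔p≤n =
  _/_ (+ L n k r p r≤k r≤p k⊔p≤n) (n C r)
      {{nCr-nonZero n r (≤-trans r≤k (≤-trans (m≤m⊔n k p) k⊔p≤n))}}

-- Real numbers as (two-sided) Dedekind cuts:  Lower q  means  q < x,
-- and  Upper q  means  x < q.

record ℝ : Set₁ where
  field
    Lower Upper     : ℚ → Set
    lower-inhabited : ∃[ q ] Lower q
    upper-inhabited : ∃[ q ] Upper q
    lower-rounded   : ∀ q → Lower q ⇔ (∃[ s ] q <ℚ s × Lower s)
    upper-rounded   : ∀ q → Upper q ⇔ (∃[ s ] s <ℚ q × Upper s)
    disjoint        : ∀ q → ¬ (Lower q × Upper q)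
    located         : ∀ q s → q <ℚ s → Lower q ⊎ Upper s

-- Convergence of a rational sequence defined from index n₀ on.  The last line
-- is  ∣ u n - x ∣ < ε,  written as  u n - ε < x < u n + ε.

ConvergesTo : (n₀ : ℕ) → (∀ n → n₀ ≤ n → ℚ) → ℝ → Set
ConvergesTo n₀ u x =
  ∀ (ε : ℚ) → 0ℚ <ℚ ε →
  ∃[ N ] (∀ n (n₀≤n : n₀ ≤ n) → N ≤ n →
    ℝ.Lower x (u n n₀≤n -ℚ ε) × ℝ.Upper x (u n n₀≤n +ℚ ε))

{-# OPTIONS --safe #-}
-- Write L(m) = L(m,k,r,p).  Take an optimal system on m points and t ≡ 1 (mod k!), and
-- replace every point by a class of t points.  An edge K becomes k classes.  The
-- polynomials of degree < r over ℤ/t, evaluated at k points whose differences are units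
-- mod t, form t^r transversals of these classes, and every choice of one point in each
-- of r of the classes extends to such a transversal.  A p-set with two points in one
-- class is met by one of m^(r-1) t^r edges that contain two points of a class (for r = 1
-- by an edge over one of the fewer than p uncovered points).  Hence
-- L(n) ≤ (L(m) + p m^(r-1)) t^r whenever n ≤ m t.  Since t can be chosen with
-- m t ≤ n + O_m(1), the ratio L(n) / C(n,r) is eventually at most L(m) / C(m,r) + O(1/m),
-- so its upper limit does not exceed its lower limit.
module Submission where

open import Axiom.ExcludedMiddle using (ExcludedMiddle)
open import Defs
open import Data.Nat using (ℕ; _≤_; _⊔_)
open import Data.Product using (∃-syntax)
open import Level using (0ℓ)

open import Data.Bool.Properties using () renaming (_≟_ to _≟ᵇ_)
open import Data.Fin
  using (Fin; zero; suc; toℕ; fromℕ<; finToFun; funToFin; inject≤; punchIn; punchOut; remQuot; combine)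
open import Data.Fin.Properties
  using ( _≟_; any?; toℕ-injective; toℕ-fromℕ<; fromℕ<-toℕ; toℕ<n; suc-injective; injective⇒≤
        ; inject≤-injective; toℕ-inject≤; finToFun-funToFin; punchIn-injective; punchInᵢ≢i
        ; punchIn-punchOut; remQuot-combine; combine-remQuot; *↔×; +↔⊎)
open import Data.Fin.Subset using (Subset; inside; outside; ∣_∣; _∩_; _∈_; _⊆_)
open import Data.Fin.Subset.Properties using (∣p∣≤n; x∈p∩q⁺; x∈p∩q⁻; ⊆-refl; s⊆s; out⊆)
open import Data.Integer as ℤ using (ℤ; +_; -[1+_]; 0ℤ; 1ℤ)
open import Data.Integer.DivMod using (_%ℕ_; _/ℕ_; n%ℕd<d; a≡a%ℕn+[a/ℕn]*n)
import Data.Integer.Properties as ℤ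
import Data.Integer.Tactic.RingSolver as ℤ
open import Data.List as List using (List)
open import Data.List.Membership.Propositional using (lose)
open import Data.List.Membership.Propositional.Properties using (∈-deduplicate⁺; ∈-tabulate⁺; ∈-lookup)
open import Data.List.Properties using (length-deduplicate; length-tabulate)
open import Data.List.Relation.Unary.All as All using (All)
import Data.List.Relation.Unary.All.Properties as All
open import Data.List.Relation.Unary.Any as Any using (Any)
open import Data.List.Relation.Unary.Any.Properties using (lookup-index)
import Data.List.Relation.Unary.Unique.DecPropositional.Properties as Unique
open import Data.Nat as ℕ using (zero; suc; _!; NonZero; s≤s; z≤n)
open import Data.Nat.Combinatorics using (_C_; nCk≡n!/k![n-k]!; k![n∸k]!∣n!)
import Data.Nat.Coprimality as Coprime
import Data.Nat.Divisibility as ℕ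
import Data.Nat.DivMod as ℕ
import Data.Nat.Properties as ℕ
open import Data.Product using (∃; _×_; _,_; proj₁; proj₂; uncurry)
open import Data.Product.Function.NonDependent.Propositional using (_×-↔_)
open import Data.Rational as ℚ using (ℚ; 0ℚ; 1ℚ; ½; toℚᵘ; ↥_; ↧_; ↧ₙ_; Positive; mkℚ)
import Data.Rational.Properties as ℚ
open import Data.Rational.Solver using (module +-*-Solver)
open import Data.Rational.Unnormalised as ℚᵘ using (mkℚᵘ; *≡*; *<*)
import Data.Rational.Unnormalised.Properties as ℚᵘ
open import Data.Sum using (_⊎_; inj₁; inj₂; map₂)
open import Data.Sum.Function.Propositional using (_⊎-↔_)
open import Data.Vec using ([]; _∷_; tabulate; here; there)
open import Data.Vec.Functional using () renaming (_∷_ to _◂_)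
open import Data.Vec.Properties using (≡-dec; lookup∘tabulate; []=⇒lookup; lookup⇒[]=)
open import Function using (_∘_; _↔_; Inverse; mk⇔)
open import Function.Construct.Composition using () renaming (inverse to ↔-trans)
open import Function.Construct.Identity using (↔-id)
open import Function.Definitions using (Injective)
open import Relation.Binary.Definitions using (tri<; tri≈; tri>)
open import Relation.Binary.PropositionalEquality
open import Relation.Nullary using (¬_; yes; no; contradiction; does)
open import Relation.Nullary.Decidable using (dec-true)

-- Interpolation by polynomials over ℤ / (1 + j k!)

module _ where

  open import Data.Integer using (_+_; _*_; -_; _-_)
  open import Data.Integer.Tactic.RingSolver using (solve-∀)

  infix 4 _≈_[mod_]

  -- The quotient is explicit data, so matching on `refl` turns each congruence law into a ring
  -- identity.
  record _≈_[mod_] (a b : ℤ) (t : ℕ) : Set where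
    constructor quotient
    field
      q  : ℤ
      eq : a ≡ b + q * + t

  ≈-trans : ∀ {t a b c} → a ≈ b [mod t ] → b ≈ c [mod t ] → a ≈ c [mod t ]
  ≈-trans {t} {c = c} (quotient q refl) (quotient q′ refl) = quotient (q′ + q) (lemma c q′ q (+ t))
    where
    lemma : ∀ c q′ q t → c + q′ * t + q * t ≡ c + (q′ + q) * t
    lemma = solve-∀

  affine-cong : ∀ {t a b} c d → a ≈ b [mod t ] → c + d * a ≈ c + d * b [mod t ]
  affine-cong {t} {b = b} c d (quotient q refl) = quotient (d * q) (lemma b c d q (+ t))
    where
    lemma : ∀ b c d q t → c + d * (b + q * t) ≡ c + d * b + d * q * t
    lemma = solve-∀

  %ℕ-≈ : ∀ a t .{{_ : NonZero t}} → + (a %ℕ t) ≈ a [mod t ]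
  %ℕ-≈ a t = quotient (- (a /ℕ t)) (begin
    + (a %ℕ t)            ≡⟨ lemma (+ (a %ℕ t)) (a /ℕ t) (+ t) ⟩
    + (a %ℕ t) + (a /ℕ t) * + t + - (a /ℕ t) * + t
      ≡⟨ cong (_+ - (a /ℕ t) * + t) (a≡a%ℕn+[a/ℕn]*n a t) ⟨
    a + - (a /ℕ t) * + t  ∎)
    where
    open ≡-Reasoning
    lemma : ∀ r q t → r ≡ r + q * t + - q * t
    lemma = solve-∀

  residue-unique : ∀ {t a b} → a ℕ.< t → b ℕ.< t → + a ≈ + b [mod t ] → a ≡ b
  residue-unique {t} {a} {b} a<t b<t (quotient q eq) = go q eq
    where
    instance t≢0 : NonZero t
             t≢0 = ℕ.>-nonZero (ℕ.≤-trans (ℕ.s≤s ℕ.z≤n) a<t)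
    open ≡-Reasoning
    nat : ∀ {a b} q → a ℕ.< t → b ℕ.< t → a ≡ b ℕ.+ q ℕ.* t → a ≡ b
    nat {a} {b} q a<t b<t eq = begin
      a                      ≡⟨ ℕ.m<n⇒m%n≡m a<t ⟨
      a ℕ.% t                ≡⟨ cong (ℕ._% t) eq ⟩
      (b ℕ.+ q ℕ.* t) ℕ.% t  ≡⟨ ℕ.[m+kn]%n≡m%n b q t ⟩
      b ℕ.% t                ≡⟨ ℕ.m<n⇒m%n≡m b<t ⟩
      b                      ∎
    swap : ∀ a b q t → a ≡ b + - q * t → b ≡ a + q * t
    swap a b q t refl = lemma b q t
      where
      lemma : ∀ b q t → b ≡ b + - q * t + q * t
      lemma = solve-∀
    toNat : ∀ a b q → + a ≡ + b + + q * + t → a ≡ b ℕ.+ q ℕ.* t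
    toNat a b q eq = ℤ.+-injective (trans eq (cong (_+_ (+ b)) (sym (ℤ.pos-* q t))))
    go : ∀ q → + a ≡ + b + q * + t → a ≡ b
    go (+ q) eq = nat q a<t b<t (toNat a b q eq)
    -- A negative quotient exchanges the roles of `a` and `b`, so that both cases are decided by
    -- remainders in ℕ.
    go -[1+ q ] eq = sym (nat (suc q) b<t a<t (toNat b a (suc q) (swap (+ a) (+ b) (+ suc q) (+ t) eq)))

  eval : ∀ {r} → (Fin r → ℤ) → ℤ → ℤ
  eval {zero}  φ x = 0ℤ
  eval {suc r} φ x = φ zero + x * eval (φ ∘ suc) x

  eval-cong : ∀ {t r} (φ ψ : Fin r → ℤ) → (∀ i → φ i ≈ ψ i [mod t ]) →
              ∀ x → eval φ x ≈ eval ψ x [mod t ]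
  eval-cong {r = zero}  φ ψ φ≈ψ x = quotient 0ℤ refl
  eval-cong {t} {suc r} φ ψ φ≈ψ x =
    ≈-trans (affine-cong (φ zero) x (eval-cong (φ ∘ suc) (ψ ∘ suc) (φ≈ψ ∘ suc) x))
            (shift (φ≈ψ zero))
    where
    lemma : ∀ b e q t → b + q * t + e ≡ b + e + q * t
    lemma = solve-∀
    shift : ∀ {a b e} → a ≈ b [mod t ] → a + e ≈ b + e [mod t ]
    shift {b = b} {e} (quotient q refl) = quotient q (lemma b e q (+ t))

  -- Rewrites one step of Newton's form in coefficients: for g = a + x h the recursion is y + (x -
  -- s) g = (y - s a) + x (a + (x - s) h).
  newtonStep : ∀ {r} (g : Fin r → ℤ) (s y : ℤ) →
               ∃[ f ] (∀ x → eval {suc r} f x ≡ y + (x - s) * eval g x)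
  newtonStep {zero} g s y = y ◂ g , λ x → lemma x s y
    where
    lemma : ∀ x s y → y + x * 0ℤ ≡ y + (x - s) * 0ℤ
    lemma = solve-∀
  newtonStep {suc r} g s y =
    let f , eval-f = newtonStep (g ∘ suc) s (g zero)
    in  (y - s * g zero) ◂ f
      , λ x → trans (cong (λ e → y - s * g zero + x * e) (eval-f x))
                    (lemma x s y (g zero) (eval (g ∘ suc) x))
    where
    lemma : ∀ x s y a e → y - s * a + x * (a + (x - s) * e) ≡ y + (x - s) * (a + x * e)
    lemma = solve-∀

  -- Newton interpolation. It divides only by differences of nodes, so units suffice and `t` may be
  -- composite.
  interpolate : ∀ {t r} (x y : Fin r → ℤ) →
                (∀ i j → i ≢ j → ∃[ e ] (x i - x j) * e ≈ 1ℤ [mod t ]) →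
                ∃[ f ] (∀ i → eval {r} f (x i) ≈ y i [mod t ])
  interpolate {r = zero} x y units = (λ ()) , λ ()
  interpolate {t} {suc r} x y units = f , hits
    where
    inv : ∀ i → ∃[ e ] (x (suc i) - x zero) * e ≈ 1ℤ [mod t ]
    inv i = units (suc i) zero λ ()
    -- The divided difference with respect to node `zero`, formed with the inverse modulo `t`.
    slope : Fin r → ℤ
    slope i = proj₁ (inv i) * (y (suc i) - y zero)
    rest : ∃[ g ] (∀ i → eval g (x (suc i)) ≈ slope i [mod t ])
    rest = interpolate (x ∘ suc) slope λ i j i≢j → units (suc i) (suc j) λ { refl → i≢j refl }
    g = proj₁ rest
    f = proj₁ (newtonStep g (x zero) (y zero))
    eval-f = proj₂ (newtonStep g (x zero) (y zero))
    assoc : ∀ b d e c → b + d * (e * c) ≡ b + c * (d * e)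
    assoc = solve-∀
    collapse : ∀ b c → b + (c - b) * 1ℤ ≡ c
    collapse = solve-∀
    vanish : ∀ a b e → b + (a - a) * e ≡ b + 0ℤ
    vanish = solve-∀
    hits : ∀ i → eval f (x i) ≈ y i [mod t ]
    hits zero = quotient 0ℤ (trans (eval-f (x zero)) (vanish (x zero) (y zero) (eval g (x zero))))
    hits (suc i) = ≈-trans (quotient 0ℤ (trans (eval-f (x (suc i))) (sym (ℤ.+-identityʳ _))))
      (≈-trans (affine-cong (y zero) (x (suc i) - x zero) (proj₂ rest i))
        (subst₂ (_≈_[mod t ])
          (sym (assoc (y zero) (x (suc i) - x zero) (proj₁ (inv i)) (y (suc i) - y zero)))
          (collapse (y zero) (y (suc i)))
          (affine-cong (y zero) (y (suc i) - y zero) (proj₂ (inv i)))))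

  -- For 1 ≤ d ≤ k, d c = k! gives d (- c j) = - j k! = 1 - (1 + j k!).
  factor-invertible : ∀ {k d} j → 1 ≤ d → d ≤ k →
                      ∃[ e ] + d * e ≈ 1ℤ [mod suc (j ℕ.* k !) ]
  factor-invertible {k} {suc d} j _ d≤k =
    let ℕ.divides c k!≡ = ℕ.∣-trans (ℕ.m∣m*n {suc d} (d !)) (ℕ.m≤n⇒m!∣n! d≤k)
    in  - (+ c * + j) , quotient (- 1ℤ) (begin
      + suc d * - (+ c * + j)        ≡⟨ lemma (+ suc d) (+ c) (+ j) ⟩
      1ℤ + - 1ℤ * (1ℤ + + j * (+ c * + suc d))
        ≡⟨ cong (λ z → 1ℤ + - 1ℤ * (1ℤ + + j * z)) (ℤ.pos-* c (suc d)) ⟨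
      1ℤ + - 1ℤ * (1ℤ + + j * + (c ℕ.* suc d))
        ≡⟨ cong (λ z → 1ℤ + - 1ℤ * (1ℤ + + j * + z)) k!≡ ⟨
      1ℤ + - 1ℤ * (1ℤ + + j * + (k !))
        ≡⟨ cong (λ z → 1ℤ + - 1ℤ * (1ℤ + z)) (ℤ.pos-* j (k !)) ⟨
      1ℤ + - 1ℤ * + suc (j ℕ.* k !)  ∎)
    where
    open ≡-Reasoning
    lemma : ∀ d c j → d * - (c * j) ≡ 1ℤ + - 1ℤ * (1ℤ + j * (c * d))
    lemma = solve-∀

  -- The absolute difference lies between 1 and k and hence divides k!. When the difference is
  -- negative, the inverse is negated.
  differences-invertible : ∀ {k} j (a b : Fin k) → a ≢ b →
    ∃[ e ] (+ toℕ a - + toℕ b) * e ≈ 1ℤ [mod suc (j ℕ.* k !) ]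
  differences-invertible {k} j a b a≢b with ℕ.<-cmp (toℕ a) (toℕ b)
  ... | tri≈ _ a≡b _ = contradiction (toℕ-injective a≡b) a≢b
  ... | tri< a<b _ _ =
    let e , quotient q eq = factor-invertible j (ℕ.m<n⇒0<n∸m a<b)
                       (ℕ.≤-trans (ℕ.m∸n≤m (toℕ b) (toℕ a)) (ℕ.<⇒≤ (toℕ<n b)))
        d          = + (toℕ b ℕ.∸ toℕ a)
    in  - e , quotient q (trans (cong (λ z → (+ toℕ a - + z) * - e) (sym (ℕ.m+[n∸m]≡n (ℕ.<⇒≤ a<b))))
                        (trans (lemma (+ toℕ a) d e) eq))
    where
    lemma : ∀ a d e → (a - (a + d)) * - e ≡ d * e
    lemma = solve-∀
  ... | tri> _ _ b<a =
    let e , quotient q eq = factor-invertible j (ℕ.m<n⇒0<n∸m b<a)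
                       (ℕ.≤-trans (ℕ.m∸n≤m (toℕ a) (toℕ b)) (ℕ.<⇒≤ (toℕ<n a)))
        d          = + (toℕ a ℕ.∸ toℕ b)
    in  e , quotient q (trans (cong (λ z → (+ z - + toℕ b) * e) (sym (ℕ.m+[n∸m]≡n (ℕ.<⇒≤ b<a))))
                      (trans (lemma (+ toℕ b) d e) eq))
    where
    lemma : ∀ b d e → ((b + d) - b) * e ≡ d * e
    lemma = solve-∀

  -- Orthogonal arrays of strength r

  module _ (r k j : ℕ) where

    private
      t : ℕ
      t = suc (j ℕ.* k !)

      coefficients : Fin (t ℕ.^ r) → Fin r → ℤ
      coefficients c = +_ ∘ toℕ ∘ finToFun c

    -- The rows are the polynomials of degree < r over ℤ/t, with the base-t digits of the row number
    -- as coefficients; the columns are the points 0, ..., k - 1.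
    orthogonalArray : Fin (t ℕ.^ r) → Fin k → Fin t
    orthogonalArray c x = fromℕ< (n%ℕd<d (eval (coefficients c) (+ toℕ x)) t)

    -- The interpolating polynomial has integer coefficients; reducing them modulo t gives a row
    -- number and preserves the values modulo t.
    orthogonalArray-surjective : (s : Fin r → Fin k) → Injective _≡_ _≡_ s →
      (y : Fin r → Fin t) → ∃[ c ] (∀ i → orthogonalArray c (s i) ≡ y i)
    orthogonalArray-surjective s s-inj y = c , λ i → toℕ-injective (trans (toℕ-fromℕ< _)
        (residue-unique (n%ℕd<d (eval (coefficients c) (+ toℕ (s i))) t) (toℕ<n (y i))
          (≈-trans (%ℕ-≈ (eval (coefficients c) (+ toℕ (s i))) t)
            (≈-trans (eval-cong (coefficients c) f c≈f (+ toℕ (s i))) (proj₂ poly i)))))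
      where
      poly : ∃[ f ] (∀ i → eval {r} f (+ toℕ (s i)) ≈ + toℕ (y i) [mod t ])
      poly = interpolate (λ i → + toℕ (s i)) (λ i → + toℕ (y i))
               λ i i′ i≢i′ → differences-invertible j (s i) (s i′) (i≢i′ ∘ s-inj)
      f = proj₁ poly
      residue : Fin r → Fin t
      residue i = fromℕ< (n%ℕd<d (f i) t)
      c : Fin (t ℕ.^ r)
      c = funToFin residue
      c≈f : ∀ i → coefficients c i ≈ f i [mod t ]
      c≈f i = subst (λ z → + z ≈ f i [mod t ])
        (sym (trans (cong toℕ (finToFun-funToFin residue i)) (toℕ-fromℕ< (n%ℕd<d (f i) t))))
        (%ℕ-≈ (f i) t)

-- Covers by enumerated edges and their blow-ups

module _ where

  open import Data.Nat using (_+_; _*_; _^_)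
  open import Data.Nat.Tactic.RingSolver using (solve-∀)

  private variable
    A B V W I : Set
    k r p m n N : ℕ

  -- e and P enumerate an edge and a p-set; e may repeat vertices, so that an edge may have fewer than k.
  record Meets (r : ℕ) (e : Fin k → V) (P : Fin p → V) : Set where
    constructor meets
    field
      {position}   : Fin r → Fin k
      {choice}     : Fin r → Fin p
      choice-inj   : Injective _≡_ _≡_ choice
      agree        : ∀ i → e (position i) ≡ P (choice i)

  Covers : (r p : ℕ) → (I → Fin k → V) → Set
  Covers {V = V} r p E = ∀ (P : Fin p → V) → Injective _≡_ _≡_ P → ∃[ c ] Meets r (E c) P

  -- Edges are counted by an index and may coincide, so the size of a constructed family is read off
  -- its index type. Duplicates are removed only in `cover⇒system`.
  HasCover : (k r p : ℕ) → Set → ℕ → Set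
  HasCover k r p V N = ∃[ E ] Covers {I = Fin N} {k = k} {V = V} r p E

  reindex : Fin N ↔ I → {E : I → Fin k → V} → Covers r p E → HasCover k r p V N
  reindex {r = r} f {E} cov = E ∘ Inverse.to f , λ P P-inj →
    let c , hit = cov P P-inj
    in  Inverse.from f c , subst (λ c → Meets r (E c) P) (sym (Inverse.strictlyInverseˡ f c)) hit

  -- Only p-sets inside the image of `ι` have to be met, so `ρ` may send all other vertices
  -- anywhere, even if edges collapse.
  retract : (ι : W → V) (ρ : V → W) → (∀ w → ρ (ι w) ≡ w) →
            HasCover k r p V N → HasCover k r p W N
  retract ι ρ ρι (E , cov) = (λ c → ρ ∘ E c) , λ P P-inj →
    let c , meets choice-inj agree = cov (ι ∘ P) λ {x} {y} eq →
          P-inj (trans (sym (ρι (P x))) (trans (cong ρ eq) (ρι (P y))))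
    in  c , meets choice-inj λ i → trans (cong ρ (agree i)) (ρι _)

  ◂-injective : {x : A} {f : Fin n → A} → (∀ i → f i ≢ x) → Injective _≡_ _≡_ f →
                Injective _≡_ _≡_ (x ◂ f)
  ◂-injective fresh f-inj {zero}  {zero}  eq = refl
  ◂-injective fresh f-inj {zero}  {suc j} eq = contradiction (sym eq) (fresh j)
  ◂-injective fresh f-inj {suc i} {zero}  eq = contradiction eq (fresh i)
  ◂-injective fresh f-inj {suc i} {suc j} eq = cong suc (f-inj eq)

  -- Puts a pair of points from one class first and adds `r` further points of the p-set, in the
  -- order that `degenerate` expects.
  injection-through : 2 + r ≤ p → {i j : Fin p} → i ≢ j →
    ∃ λ (g : Fin (2 + r) → Fin p) → Injective _≡_ _≡_ g × g zero ≡ i × g (suc zero) ≡ j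
  injection-through {r} {suc (suc p)} (s≤s (s≤s r≤p)) {i} {j} i≢j =
      i ◂ punchIn i ∘ h
    , ◂-injective (λ x → punchInᵢ≢i i (h x)) (λ {x} {y} eq → h-inj (punchIn-injective i (h x) (h y) eq))
    , refl
    , punchIn-punchOut i≢j
    where
    h′ : Fin r → Fin p
    h′ x = inject≤ x r≤p
    h : Fin (suc r) → Fin (suc p)
    h = punchOut i≢j ◂ punchIn (punchOut i≢j) ∘ h′
    h-inj : Injective _≡_ _≡_ h
    h-inj = ◂-injective (λ x → punchInᵢ≢i (punchOut i≢j) (h′ x))
      λ {x} {y} eq → inject≤-injective r≤p r≤p x y (punchIn-injective (punchOut i≢j) (h′ x) (h′ y) eq)

  -- Pads a short edge to `k` positions by repeating one vertex.
  extendBy : A → (Fin r → A) → Fin k → A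
  extendBy {r = zero}  a f x       = a
  extendBy {r = suc r} a f zero    = f zero
  extendBy {r = suc r} a f (suc x) = extendBy a (f ∘ suc) x

  extendBy-inject≤ : ∀ {a : A} (f : Fin r → A) (r≤k : r ≤ k) i →
                     extendBy a f (inject≤ i r≤k) ≡ f i
  extendBy-inject≤ {k = suc k} f r≤k       zero    = refl
  extendBy-inject≤ {k = suc k} f (s≤s r≤k) (suc i) = extendBy-inject≤ (f ∘ suc) r≤k i

  *-^-distrib : ∀ m n r → (m * n) ^ r ≡ m ^ r * n ^ r
  *-^-distrib m n zero    = refl
  *-^-distrib m n (suc r) = trans (cong (m * n *_) (*-^-distrib m n r)) (lemma m n (m ^ r) (n ^ r))
    where
    lemma : ∀ m n a b → m * n * (a * b) ≡ m * a * (n * b)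
    lemma = solve-∀

  -- Blow-ups of covers

  module _ (em : ExcludedMiddle 0ℓ) where

    collision-or-injective : (f : Fin n → A) →
      (∃[ i ] ∃[ j ] i ≢ j × f i ≡ f j) ⊎ Injective _≡_ _≡_ f
    collision-or-injective f with em {∃[ i ] ∃[ j ] i ≢ j × f i ≡ f j}
    ... | yes collision = inj₁ collision
    ... | no  none = inj₂ injective
      where
      injective : Injective _≡_ _≡_ f
      injective {i} {j} eq with i ≟ j
      ... | yes i≡j = i≡j
      ... | no  i≢j = contradiction (i , j , i≢j , eq) none

    -- For r = 1, distinct vertices lying on no edge number fewer than `p`, because `p` of them
    -- would form a p-set that is not met. They are collected greedily.
    exceptions : (E : I → Fin k → V) → Covers 1 p E → V →
                 ∃ λ (U : Fin p → V) → ∀ v → (∃[ c ] ∃[ x ] E c x ≡ v) ⊎ (∃[ i ] U i ≡ v)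
    exceptions {I} {k} {V} {p} E cov v₀ with greedy p
      where
      Hit : V → Set
      Hit v = ∃[ c ] ∃[ x ] E c x ≡ v
      greedy : ∀ q → (∃ λ (f : Fin q → V) → Injective _≡_ _≡_ f × (∀ i → ¬ Hit (f i)))
                   ⊎ (∃ λ (U : Fin q → V) → ∀ v → Hit v ⊎ (∃[ i ] U i ≡ v))
      greedy zero = inj₁ ((λ ()) , (λ {}) , λ ())
      greedy (suc q) with greedy q
      ... | inj₂ (U , exc) = inj₂ (v₀ ◂ U , λ v → map₂ (λ (i , eq) → suc i , eq) (exc v))
      ... | inj₁ (f , f-inj , miss) with em {∃[ v ] ¬ Hit v × (∀ i → f i ≢ v)}
      ...   | yes (v , v-miss , fresh) =
                inj₁ (v ◂ f , ◂-injective fresh f-inj , λ { zero → v-miss ; (suc i) → miss i })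
      -- No further uncovered vertex exists, so `f` lists them all; `v₀` only fills up the list.
      ...   | no  none = inj₂ (v₀ ◂ f , exc)
        where
        exc : ∀ v → Hit v ⊎ (∃[ i ] (v₀ ◂ f) i ≡ v)
        exc v with em {Hit v} | em {∃[ i ] f i ≡ v}
        ... | yes hit  | _            = inj₁ hit
        ... | no _     | yes (i , eq) = inj₂ (suc i , eq)
        ... | no v-miss | no fresh    = contradiction (v , v-miss , λ i eq → fresh (i , eq)) none
    ... | inj₂ exc = exc
    ... | inj₁ (f , f-inj , miss) =
      let c , meets {position} {choice} _ agree = cov f f-inj
      in  contradiction (c , position zero , agree zero) (miss (choice zero))

    module _ (j : ℕ) where

      private
        -- The class size t, congruent to 1 modulo k! so that the orthogonal array exists.
        part : ℕ → ℕ
        part k = suc (j * k !)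

      transversals : ∀ r → (E : I → Fin k → V) → I × Fin (part k ^ r) → Fin k → V × Fin (part k)
      transversals {k = k} r E (c , d) x = E c x , orthogonalArray r k j d x

      -- Points in distinct classes project to a p-set of V, which some edge meets in r places; a
      -- row of the array then takes the prescribed points of the classes at these places.
      transversals-meet : (E : I → Fin k → V) → Covers r p E → (P : Fin p → V × Fin (part k)) →
                          Injective _≡_ _≡_ (proj₁ ∘ P) →
                          ∃[ c ] Meets r (transversals r E c) P
      transversals-meet {k = k} {r = r} E cov P π-inj =
        let c , meets {position} {choice} choice-inj agree = cov (proj₁ ∘ P) π-inj
            d , array = orthogonalArray-surjective r k j position
                  -- The r positions are distinct because the vertices found there are.
                  (λ {x} {y} eq → choice-inj (π-inj (trans (sym (agree x)) (trans (cong (E c) eq) (agree y)))))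
                  (proj₂ ∘ P ∘ choice)
        in  (c , d) , meets choice-inj λ i → cong₂ _,_ (agree i) (array i)

      -- A p-set with points in distinct classes is met by a transversal. Otherwise two of its
      -- points share a class, and a degenerate edge contains them: `m` classes, `t` choices for
      -- each of the two points, and `m * t` for each of the remaining `r`.
      blowUp₂ : (E : Fin N → Fin k → Fin m) → Covers (2 + r) p E → 2 + r ≤ k → 2 + r ≤ p →
                HasCover k (2 + r) p (Fin m × Fin (part k))
                  (N * part k ^ (2 + r) + m * (part k * (part k * (m * part k) ^ r)))
      blowUp₂ {N} {k} {m} {r} {p} E cov r≤k r≤p = reindex index blownUp-covers
        where
        t = part k
        I′ = (Fin N × Fin (t ^ (2 + r))) ⊎ (Fin m × Fin t × Fin t × Fin ((m * t) ^ r))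
        index : Fin (N * t ^ (2 + r) + m * (t * (t * (m * t) ^ r))) ↔ I′
        index = ↔-trans +↔⊎
          (*↔× ⊎-↔ ↔-trans *↔× (↔-id _ ×-↔ ↔-trans *↔× (↔-id _ ×-↔ *↔×)))
        degenerate : Fin m × Fin t × Fin t × Fin ((m * t) ^ r) → Fin (2 + r) → Fin m × Fin t
        degenerate (v , τ , τ′ , d) = (v , τ) ◂ ((v , τ′) ◂ (remQuot t ∘ finToFun d))
        blownUp : I′ → Fin k → Fin m × Fin t
        blownUp (inj₁ c)           = transversals (2 + r) E c
        blownUp (inj₂ c@(v , τ , _)) = extendBy (v , τ) (degenerate c)
        blownUp-covers : Covers (2 + r) p blownUp
        blownUp-covers P P-inj with collision-or-injective (proj₁ ∘ P)
        ... | inj₂ π-inj = let c , hit = transversals-meet E cov P π-inj in inj₁ c , hit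
        ... | inj₁ (i , i′ , i≢i′ , eq) with injection-through r≤p i≢i′
        ...   | g , g-inj , refl , refl = inj₂ c , meets {position = λ x → inject≤ x r≤k} g-inj λ x →
                  trans (extendBy-inject≤ (degenerate c) r≤k x) (agree x)
          where
          rest : Fin r → Fin (m * t)
          rest x = combine (proj₁ (P (g (suc (suc x))))) (proj₂ (P (g (suc (suc x)))))
          c = proj₁ (P i) , proj₂ (P i) , proj₂ (P i′) , funToFin rest
          agree : ∀ x → degenerate c x ≡ P (g x)
          agree zero = refl
          agree (suc zero) = cong (_, proj₂ (P i′)) eq
          agree (suc (suc x)) = trans (cong (remQuot t) (finToFun-funToFin rest x)) (remQuot-combine _ _)

      -- For r = 1 a single point of the p-set is enough. Either its class lies on an edge, and a
      -- transversal runs through the point, or the class is an exception, and the point alone forms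
      -- a constant edge; this adds at most `p * t` edges.
      blowUp₁ : (E : Fin N → Fin (suc k) → Fin m) → Covers 1 p E → 1 ≤ p → Fin m →
                HasCover (suc k) 1 p (Fin m × Fin (part (suc k))) (N * part (suc k) ^ 1 + p * part (suc k))
      blowUp₁ {N} {k′} {m} {suc p} E cov (s≤s _) v₀ =
        reindex (↔-trans +↔⊎ (*↔× ⊎-↔ *↔×)) {blownUp} blownUp-covers
        where
        t = part (suc k′)
        U = proj₁ (exceptions E cov v₀)
        blownUp : (Fin N × Fin (t ^ 1)) ⊎ (Fin (suc p) × Fin t) → Fin (suc k′) → Fin m × Fin t
        blownUp (inj₁ c)       = transversals 1 E c
        blownUp (inj₂ (i , τ)) _ = U i , τ
        blownUp-covers : Covers 1 (suc p) blownUp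
        blownUp-covers P P-inj with proj₂ (exceptions E cov v₀) (proj₁ (P zero))
        ... | inj₁ (c , x , eq) =
          let d , array = orthogonalArray-surjective 1 (suc k′) j (λ _ → x)
                (λ { {zero} {zero} _ → refl }) (λ _ → proj₂ (P zero))
          in  inj₁ (c , d) , meets {position = λ _ → x} {choice = λ _ → zero}
                (λ { {zero} {zero} _ → refl }) λ { zero → cong₂ _,_ eq (array zero) }
        ... | inj₂ (i , eq) = inj₂ (i , proj₂ (P zero)) , meets {position = λ _ → zero} {choice = λ _ → zero}
                (λ { {zero} {zero} _ → refl }) λ { zero → cong (_, proj₂ (P zero)) eq }

      -- One bound for both constructions: the factor `p` comes from the exceptional vertices when
      -- the intersection size is 1, and is a weakening of 1 in the other case.
      blowUp-size : suc r ≤ k → suc r ≤ p → 1 ≤ m → HasCover k (suc r) p (Fin m) N →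
                    ∃[ N′ ] N′ ≤ (N + p * m ^ r) * part k ^ suc r
                          × HasCover k (suc r) p (Fin m × Fin (part k)) N′
      blowUp-size {zero} {suc k} {p} {suc m} {N} _ r≤p _ (E , cov) =
        _ , ℕ.≤-reflexive (lemma N p (part (suc k))) , blowUp₁ E cov r≤p zero
        where
        lemma : ∀ N p t → N * (t * 1) + p * t ≡ (N + p * 1) * (t * 1)
        lemma = solve-∀
      blowUp-size {suc r} {k} {suc p} {m} {N} r≤k r≤p _ (E , cov) = _ , bound , blowUp₂ E cov r≤k r≤p
        where
        t = part k
        expand : ∀ N m t a b c → N * c + m * (t * (t * (a * b))) ≡ N * c + m * a * (t * (t * b))
        expand = solve-∀
        open ℕ.≤-Reasoning
        bound : N * t ^ (2 + r) + m * (t * (t * (m * t) ^ r))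
                ≤ (N + suc p * m ^ suc r) * t ^ (2 + r)
        bound = begin
          N * t ^ (2 + r) + m * (t * (t * (m * t) ^ r))
            ≡⟨ cong (λ z → N * t ^ (2 + r) + m * (t * (t * z))) (*-^-distrib m t r) ⟩
          N * t ^ (2 + r) + m * (t * (t * (m ^ r * t ^ r)))
            ≡⟨ expand N m t (m ^ r) (t ^ r) (t ^ (2 + r)) ⟩
          N * t ^ (2 + r) + m ^ suc r * t ^ (2 + r)
            ≡⟨ ℕ.*-distribʳ-+ (t ^ (2 + r)) N (m ^ suc r) ⟨
          (N + m ^ suc r) * t ^ (2 + r)
            ≤⟨ ℕ.*-monoˡ-≤ (t ^ (2 + r)) (ℕ.+-monoʳ-≤ N (ℕ.m≤m+n (m ^ suc r) (p * m ^ suc r))) ⟩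
          (N + suc p * m ^ suc r) * t ^ (2 + r)     ∎

-- Translation between covers and lottery systems

module _ where

  private variable
    k r p m n N : ℕ

  -- Links the cardinality of a subset to maps between `Fin` types, so that comparisons of sizes
  -- reduce to `injective⇒≤`.
  record Enumeration (S : Subset n) : Set where
    field
      element    : Fin ∣ S ∣ → Fin n
      injective  : Injective _≡_ _≡_ element
      element-∈  : ∀ i → element i ∈ S
      index      : ∀ {x} → x ∈ S → Fin ∣ S ∣
      element-index : ∀ {x} (x∈S : x ∈ S) → element (index x∈S) ≡ x

    index-injective : ∀ {x y} (x∈S : x ∈ S) (y∈S : y ∈ S) → index x∈S ≡ index y∈S → x ≡ y
    index-injective x∈S y∈S eq = trans (sym (element-index x∈S)) (trans (cong element eq) (element-index y∈S))

  open Enumeration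

  enumerate : (S : Subset n) → Enumeration S
  enumerate [] = record
    { element = λ () ; injective = λ {} ; element-∈ = λ () ; index = λ () ; element-index = λ () }
  enumerate (outside ∷ S) = record
    { element = suc ∘ element E
    ; injective = injective E ∘ suc-injective
    ; element-∈ = there ∘ element-∈ E
    ; index = λ { (there x∈S) → index E x∈S }
    ; element-index = λ { (there x∈S) → cong suc (element-index E x∈S) } }
    where E = enumerate S
  enumerate (inside ∷ S) = record
    { element = λ { zero → zero ; (suc i) → suc (element E i) }
    ; injective = λ { {zero} {zero} _ → refl ; {suc i} {suc j} eq → cong suc (injective E (suc-injective eq)) }
    ; element-∈ = λ { zero → here ; (suc i) → there (element-∈ E i) }
    ; index = λ { here → zero ; (there x∈S) → suc (index E x∈S) }
    ; element-index = λ { here → refl ; (there x∈S) → cong suc (element-index E x∈S) } }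
    where E = enumerate S

  image : (Fin k → Fin n) → Subset n
  image f = tabulate λ x → does (any? λ i → f i ≟ x)

  ∈-image⁺ : (f : Fin k → Fin n) → ∀ i → f i ∈ image f
  ∈-image⁺ f i = lookup⇒[]= (f i) (image f)
    (trans (lookup∘tabulate _ (f i)) (dec-true (any? λ j → f j ≟ f i) (i , refl)))

  ∈-image⁻ : (f : Fin k → Fin n) → ∀ {x} → x ∈ image f → ∃[ i ] f i ≡ x
  ∈-image⁻ f {x} x∈
    with any? (λ i → f i ≟ x)
       | trans (sym (lookup∘tabulate (λ x → does (any? λ i → f i ≟ x)) x)) ([]=⇒lookup x∈)
  ... | yes preimage | _ = preimage

  ∣image∣≤ : (f : Fin k → Fin n) → ∣ image f ∣ ≤ k
  ∣image∣≤ f = injective⇒≤ {f = preimage} λ {x} {y} eq → injective E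
      (trans (sym (proj₂ (∈-image⁻ f (element-∈ E x))))
        (trans (cong f eq) (proj₂ (∈-image⁻ f (element-∈ E y)))))
    where
    E = enumerate (image f)
    preimage : Fin ∣ image f ∣ → Fin _
    preimage x = proj₁ (∈-image⁻ f (element-∈ E x))

  injective⇒∣S∣≥ : (S : Subset n) (f : Fin k → Fin n) → Injective _≡_ _≡_ f → (∀ i → f i ∈ S) → k ≤ ∣ S ∣
  injective⇒∣S∣≥ S f f-inj f∈S = injective⇒≤ {f = λ i → index E (f∈S i)}
      λ {i} {j} eq → f-inj (index-injective E (f∈S i) (f∈S j) eq)
    where E = enumerate S

  ∣image∣≡ : (f : Fin k → Fin n) → Injective _≡_ _≡_ f → ∣ image f ∣ ≡ k
  ∣image∣≡ f f-inj = ℕ.≤-antisym (∣image∣≤ f) (injective⇒∣S∣≥ (image f) f f-inj (∈-image⁺ f))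

  -- Restores the exact edge size k, since an enumerated edge may have fewer vertices.
  superset : (S : Subset n) → ∣ S ∣ ≤ k → k ≤ n → ∃[ K ] S ⊆ K × ∣ K ∣ ≡ k
  superset {k = zero} [] _ _ = [] , ⊆-refl , refl
  superset {k = suc k} (inside ∷ S) (s≤s S≤k) (s≤s k≤n) =
    let K , S⊆K , eq = superset S S≤k k≤n in inside ∷ K , s⊆s S⊆K , cong suc eq
  superset {suc n} {k} (outside ∷ S) S≤k k≤n with k ℕ.≤? n
  ... | yes k≤n′ = let K , S⊆K , eq = superset S S≤k k≤n′ in outside ∷ K , s⊆s S⊆K , eq
  -- Here k is the size of the whole vertex set, so the omitted vertex has to be added.
  ... | no  k≰n with ℕ.≤-antisym k≤n (ℕ.≰⇒> k≰n)
  ...   | refl = let K , S⊆K , eq = superset S (∣p∣≤n S) ℕ.≤-refl in inside ∷ K , out⊆ S⊆K , cong suc eq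

  -- The r agreements are the first r elements of the intersection of the edge with `image P`.
  system⇒cover : HasSystemOfSize n k r p N → HasCover k r p (Fin n) N
  system⇒cover {n} {k} {r} {p} (𝓚 , refl , _ , sizes , covers) = edge , hit
    where
    size : ∀ c → ∣ List.lookup 𝓚 c ∣ ≡ k
    size c = All.lookup sizes (∈-lookup c)
    edge : Fin (List.length 𝓚) → Fin k → Fin n
    edge c = element (enumerate (List.lookup 𝓚 c)) ∘ subst Fin (sym (size c))
    position : ∀ c {x} → x ∈ List.lookup 𝓚 c → ∃[ i ] edge c i ≡ x
    position c x∈ = subst Fin (size c) (index E x∈)
      , trans (cong (element E) (subst-sym-subst (size c))) (element-index E x∈)
      where E = enumerate (List.lookup 𝓚 c)
    hit : ∀ P → Injective _≡_ _≡_ P → ∃[ c ] Meets r (edge c) P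
    hit P P-inj = c , meets {position = λ i → proj₁ (position c (x∈K i))} {choice = choice}
        (λ {i} {j} eq → inject≤-injective r≤ r≤ i j (injective E
          (trans (sym (proj₂ (∈-image⁻ P (x∈P i)))) (trans (cong P eq) (proj₂ (∈-image⁻ P (x∈P j)))))))
        λ i → trans (proj₂ (position c (x∈K i))) (sym (proj₂ (∈-image⁻ P (x∈P i))))
      where
      found = covers (image P) (∣image∣≡ P P-inj)
      c = Any.index found
      K = List.lookup 𝓚 c
      r≤ : r ≤ ∣ K ∩ image P ∣
      r≤ = lookup-index found
      E = enumerate (K ∩ image P)
      x∈K : ∀ i → element E (inject≤ i r≤) ∈ K
      x∈K i = proj₁ (x∈p∩q⁻ K (image P) (element-∈ E (inject≤ i r≤)))
      x∈P : ∀ i → element E (inject≤ i r≤) ∈ image P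
      x∈P i = proj₂ (x∈p∩q⁻ K (image P) (element-∈ E (inject≤ i r≤)))
      choice : Fin r → Fin p
      choice i = proj₁ (∈-image⁻ P (x∈P i))

  -- Enlarging edges to size k keeps all intersections, and removing duplicates can only lower their
  -- number.
  cover⇒system : k ≤ n → HasCover k r p (Fin n) N → ∃[ m ] m ≤ N × HasSystemOfSize n k r p m
  cover⇒system {k} {n} {r} {p} {N} k≤n (E , cov) =
      List.length 𝓚
    , ℕ.≤-trans (length-deduplicate _≟ˢ_ (List.tabulate edge)) (ℕ.≤-reflexive (length-tabulate edge))
    , 𝓚 , refl
    , Unique.deduplicate-! _≟ˢ_ (List.tabulate edge)
    , All.deduplicate⁺ _≟ˢ_ (All.tabulate⁺ λ c → proj₂ (proj₂ (super c)))
    , hit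
    where
    _≟ˢ_ = ≡-dec {n = n} _≟ᵇ_
    super : ∀ c → ∃[ K ] image (E c) ⊆ K × ∣ K ∣ ≡ k
    super c = superset (image (E c)) (∣image∣≤ (E c)) k≤n
    edge : Fin N → Subset n
    edge c = proj₁ (super c)
    𝓚 = List.deduplicate _≟ˢ_ (List.tabulate edge)
    hit : ∀ P → ∣ P ∣ ≡ p → Any (λ K → r ≤ ∣ K ∩ P ∣) 𝓚
    hit P refl =
      let F = enumerate P
          c , meets {position} {choice} choice-inj agree = cov (element F) (injective F)
      in  lose (∈-deduplicate⁺ _≟ˢ_ (∈-tabulate⁺ {f = edge} c))
            (injective⇒∣S∣≥ (edge c ∩ P) (element F ∘ choice) (choice-inj ∘ injective F)
              λ i → x∈p∩q⁺ ( subst (_∈ edge c) (agree i) (proj₁ (proj₂ (super c)) (∈-image⁺ (E c) (position i)))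
                           , element-∈ F (choice i)))

  L-isLeast : ∀ n k r p (r≤k : r ≤ k) (r≤p : r ≤ p) (n₀≤n : k ⊔ p ≤ n) →
              IsLeast (HasSystemOfSize n k r p) (L n k r p r≤k r≤p n₀≤n)
  L-isLeast n k r p r≤k r≤p n₀≤n = proj₂ (leastSystemSize n k r p r≤k r≤p n₀≤n)

  L≤cover : ∀ (r≤k : r ≤ k) (r≤p : r ≤ p) (n₀≤n : k ⊔ p ≤ n) →
            HasCover k r p (Fin n) N → L n k r p r≤k r≤p n₀≤n ≤ N
  L≤cover {r} {k} {p} {n} r≤k r≤p n₀≤n cover =
    let m , m≤N , system = cover⇒system (ℕ.≤-trans (ℕ.m≤m⊔n k p) n₀≤n) cover
    in  ℕ.≤-trans (proj₂ (L-isLeast n k r p r≤k r≤p n₀≤n) m system) m≤N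

-- Growth of L and of the binomial coefficients

module _ where

  open import Data.Nat using (_+_; _*_; _^_; _∸_; _/_; _<_)
  open import Data.Nat.Tactic.RingSolver using (solve-∀)

  private variable
    k r p m n N : ℕ

  -- A left inverse of `inject≤`, as `retract` demands; surplus vertices go to the default.
  truncate : Fin n → Fin m → Fin n
  truncate {n} default x with toℕ x ℕ.<? n
  ... | yes x<n = fromℕ< x<n
  ... | no  _   = default

  truncate-inject≤ : ∀ (default : Fin n) (n≤m : n ≤ m) i → truncate default (inject≤ i n≤m) ≡ i
  truncate-inject≤ {n} default n≤m i with toℕ (inject≤ i n≤m) ℕ.<? n
  ... | yes x<n = trans (fromℕ<-cong x<n) (fromℕ<-toℕ i (toℕ<n i))
    where
    fromℕ<-cong : .(x<n : toℕ (inject≤ i n≤m) < n) → fromℕ< x<n ≡ fromℕ< (toℕ<n i)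
    fromℕ<-cong x<n rewrite toℕ-inject≤ i n≤m = refl
  ... | no  x≮n = contradiction (subst (_< n) (sym (toℕ-inject≤ i n≤m)) (toℕ<n i)) x≮n

  shrink : ∀ {t} → 1 ≤ n → n ≤ m * t → HasCover k r p (Fin m × Fin t) N → HasCover k r p (Fin n) N
  shrink {suc n} {m} {t = t} _ n≤mt = retract
    (λ i → remQuot t (inject≤ i n≤mt))
    (truncate zero ∘ uncurry combine)
    λ i → trans (cong (truncate zero) (combine-remQuot {m} t (inject≤ i n≤mt))) (truncate-inject≤ zero n≤mt i)

  -- An optimal system on m points is read as a cover, blown up, restricted to n of the m t points,
  -- and turned back into a system.
  L-blowUp : ExcludedMiddle 0ℓ → ∀ (r≤k : suc r ≤ k) (r≤p : suc r ≤ p) →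
    ∀ (n₀≤m : k ⊔ p ≤ m) (n₀≤n : k ⊔ p ≤ n) j → n ≤ m * suc (j * k !) →
    L n k (suc r) p r≤k r≤p n₀≤n
      ≤ (L m k (suc r) p r≤k r≤p n₀≤m + p * m ^ r) * suc (j * k !) ^ suc r
  L-blowUp {r} {k} {p} {m} em r≤k r≤p n₀≤m n₀≤n j n≤mt =
    let cover = system⇒cover (proj₁ (L-isLeast m k (suc r) p r≤k r≤p n₀≤m))
        N′ , N′≤ , cover′ = blowUp-size em j r≤k r≤p (nonempty n₀≤m) cover
    in  ℕ.≤-trans (L≤cover r≤k r≤p n₀≤n (shrink (nonempty n₀≤n) n≤mt cover′)) N′≤
    where
    nonempty : ∀ {n} → k ⊔ p ≤ n → 1 ≤ n
    nonempty n₀≤n = ℕ.≤-trans (s≤s z≤n) (ℕ.≤-trans r≤k (ℕ.≤-trans (ℕ.m≤m⊔n k p) n₀≤n))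

  C*k!*a! : ∀ a k → ((a + k) C k) * (k ! * a !) ≡ (a + k) !
  C*k!*a! a k = begin
    ((a + k) C k) * (k ! * a !)
      ≡⟨ cong (λ b → ((a + k) C k) * (k ! * b !)) (ℕ.m+n∸n≡m a k) ⟨
    ((a + k) C k) * (k ! * (a + k ∸ k) !)
      ≡⟨ cong (_* (k ! * (a + k ∸ k) !)) (nCk≡n!/k![n-k]! (ℕ.m≤n+m k a)) ⟩
    (a + k) ! / (k ! * (a + k ∸ k) !) * (k ! * (a + k ∸ k) !)
      ≡⟨ ℕ.m/n*n≡m (k![n∸k]!∣n! (ℕ.m≤n+m k a)) ⟩
    (a + k) !  ∎
    where
    open ≡-Reasoning
    instance nz = k ℕ.!* (a + k ∸ k) !≢0

  -- The left factor times k! is the product (a + 1) ... (a + k), each factor of which is at least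
  -- a. Multiplying by a! turns this into a comparison with (a + k)!.
  C-lower : ∀ a k → a ^ k ≤ ((a + k) C k) * k !
  C-lower a k = ℕ.*-cancelʳ-≤ _ _ (a !) {{ a ℕ.!≢0 }} (begin
    a ^ k * a !                  ≤⟨ bound k ⟩
    (a + k) !                    ≡⟨ C*k!*a! a k ⟨
    ((a + k) C k) * (k ! * a !)  ≡⟨ ℕ.*-assoc ((a + k) C k) (k !) (a !) ⟨
    ((a + k) C k) * k ! * a !    ∎)
    where
    open ℕ.≤-Reasoning
    bound : ∀ k → a ^ k * a ! ≤ (a + k) !
    bound zero    = ℕ.≤-reflexive (trans (ℕ.+-identityʳ (a !)) (cong _! (sym (ℕ.+-identityʳ a))))
    bound (suc k) = begin
      a * a ^ k * a !          ≡⟨ ℕ.*-assoc a (a ^ k) (a !) ⟩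
      a * (a ^ k * a !)        ≤⟨ ℕ.*-mono-≤ (ℕ.≤-trans (ℕ.m≤m+n a k) (ℕ.n≤1+n _)) (bound k) ⟩
      suc (a + k) * (a + k) !  ≡⟨ cong _! (ℕ.+-suc a k) ⟨
      (a + suc k) !            ∎

  -- The same k factors are each at most a + k.
  C-upper : ∀ a k → ((a + k) C k) * k ! ≤ (a + k) ^ k
  C-upper a k = ℕ.*-cancelʳ-≤ _ _ (a !) {{ a ℕ.!≢0 }} (begin
    ((a + k) C k) * k ! * a !    ≡⟨ ℕ.*-assoc ((a + k) C k) (k !) (a !) ⟩
    ((a + k) C k) * (k ! * a !)  ≡⟨ C*k!*a! a k ⟩
    (a + k) !                    ≤⟨ bound k ⟩
    (a + k) ^ k * a !            ∎)
    where
    open ℕ.≤-Reasoning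
    bound : ∀ k → (a + k) ! ≤ (a + k) ^ k * a !
    bound zero    = ℕ.≤-reflexive (trans (cong _! (ℕ.+-identityʳ a)) (sym (ℕ.+-identityʳ (a !))))
    bound (suc k) = begin
      (a + suc k) !                          ≡⟨ cong _! (ℕ.+-suc a k) ⟩
      suc (a + k) * (a + k) !                ≤⟨ ℕ.*-monoʳ-≤ (suc (a + k)) (bound k) ⟩
      suc (a + k) * ((a + k) ^ k * a !)
        ≤⟨ ℕ.*-monoʳ-≤ (suc (a + k)) (ℕ.*-monoˡ-≤ (a !) (ℕ.^-monoˡ-≤ k (ℕ.n≤1+n (a + k)))) ⟩
      suc (a + k) * (suc (a + k) ^ k * a !)  ≡⟨ ℕ.*-assoc (suc (a + k)) (suc (a + k) ^ k) (a !) ⟨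
      suc (a + k) ^ suc k * a !              ≡⟨ cong (λ b → b ^ suc k * a !) (ℕ.+-suc a k) ⟨
      (a + suc k) ^ suc k * a !              ∎

  -- This is (1 + D/A)^r ≤ 1 + X/A without denominators; what matters is that `X` does not depend on
  -- `A`.
  shifted-power : ∀ D r → ∃[ X ] (∀ A → 1 ≤ A → A * (A + D) ^ r ≤ A ^ r * (A + X))
  shifted-power D zero = 0 , λ A _ → ℕ.≤-reflexive (lemma A)
    where
    lemma : ∀ A → A * 1 ≡ 1 * (A + 0)
    lemma = solve-∀
  shifted-power D (suc r) with shifted-power D r
  -- In (A + X)(A + D) the constant term X D is at most A X D, since A is at least 1.
  ... | X , bound = X + D + X * D , λ { A@(suc _) _ → begin
      A * ((A + D) * (A + D) ^ r)              ≡⟨ swap A (A + D) ((A + D) ^ r) ⟩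
      A * (A + D) ^ r * (A + D)                ≤⟨ ℕ.*-monoˡ-≤ (A + D) (bound A (s≤s z≤n)) ⟩
      A ^ r * (A + X) * (A + D)                ≡⟨ expand (A ^ r) A X D ⟩
      A ^ r * (A * (A + X + D) + X * D)
        ≤⟨ ℕ.*-monoʳ-≤ (A ^ r) (ℕ.+-monoʳ-≤ (A * (A + X + D)) (ℕ.m≤n*m (X * D) A)) ⟩
      A ^ r * (A * (A + X + D) + A * (X * D))  ≡⟨ collect (A ^ r) A X D ⟩
      A * A ^ r * (A + (X + D + X * D))        ∎ }
    where
    open ℕ.≤-Reasoning
    swap : ∀ A B x → A * (B * x) ≡ A * x * B
    swap = solve-∀
    expand : ∀ x A X D → x * (A + X) * (A + D) ≡ x * (A * (A + X + D) + X * D)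
    expand = solve-∀
    collect : ∀ x A X D → x * (A * (A + X + D) + A * (X * D)) ≡ A * x * (A + (X + D + X * D))
    collect = solve-∀

-- Limits of rational sequences

module _ where

  open import Data.Rational using (_/_; _+_; _*_; _-_; -_; 1/_; _<_)
  open +-*-Solver using (solve; con; _:+_; _:*_; _:-_; _:=_)

  -- `i / n` is reduced to lowest terms, so cross-multiplication passes through the unnormalised
  -- fraction.
  /≤⇒ : ∀ i n .{{_ : NonZero n}} {q} → i / n ℚ.≤ q → i ℤ.* ↧ q ℤ.≤ ↥ q ℤ.* + n
  /≤⇒ i (suc n) {q@record{}} le = ℚᵘ.drop-*≤* (ℚᵘ.≤-respˡ-≃ (ℚ.toℚᵘ-fromℚᵘ (mkℚᵘ i n)) (ℚ.toℚᵘ-mono-≤ le))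

  /<⇐ : ∀ i n .{{_ : NonZero n}} {q} → i ℤ.* ↧ q ℤ.< ↥ q ℤ.* + n → i / n < q
  /<⇐ i (suc n) {q@record{}} lt = ℚ.toℚᵘ-cancel-< (ℚᵘ.<-respˡ-≃ (ℚᵘ.≃-sym (ℚ.toℚᵘ-fromℚᵘ (mkℚᵘ i n))) (*<* lt))

  </⇐ : ∀ i n .{{_ : NonZero n}} {q} → ↥ q ℤ.* + n ℤ.< i ℤ.* ↧ q → q < i / n
  </⇐ i (suc n) {q@record{}} lt = ℚ.toℚᵘ-cancel-< (ℚᵘ.<-respʳ-≃ (ℚᵘ.≃-sym (ℚ.toℚᵘ-fromℚᵘ (mkℚᵘ i n))) (*<* lt))

  suc-/1 : ∀ n → + suc n / 1 ≡ 1ℚ + + n / 1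
  suc-/1 n = ℚ.toℚᵘ-injective (begin
    toℚᵘ (+ suc n / 1)           ≈⟨ ℚ.toℚᵘ-fromℚᵘ (mkℚᵘ (+ suc n) 0) ⟩
    mkℚᵘ (+ suc n) 0             ≈⟨ *≡* (lemma (+ n)) ⟩
    ℚᵘ.1ℚᵘ ℚᵘ.+ mkℚᵘ (+ n) 0     ≈⟨ ℚᵘ.+-congʳ ℚᵘ.1ℚᵘ (ℚᵘ.≃-sym (ℚ.toℚᵘ-fromℚᵘ (mkℚᵘ (+ n) 0))) ⟩
    toℚᵘ 1ℚ ℚᵘ.+ toℚᵘ (+ n / 1)  ≈⟨ ℚᵘ.≃-sym (ℚ.toℚᵘ-homo-+ 1ℚ (+ n / 1)) ⟩
    toℚᵘ (1ℚ + + n / 1)          ∎)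
    where
    open import Relation.Binary.Reasoning.Setoid ℚᵘ.≃-setoid
    lemma : ∀ z → (+ 1 ℤ.+ z) ℤ.* + 1 ≡ (+ 1 ℤ.* + 1 ℤ.+ z ℤ.* + 1) ℤ.* + 1
    lemma = ℤ.solve-∀

  -- The denominator is at least 1, so the numerator plus one exceeds a nonnegative `q`; for a
  -- negative `q`, 1 does.
  archimedean : ∀ q → ∃[ n ] q < + n / 1
  archimedean q@(mkℚ (+ a) d _) = suc a , </⇐ (+ suc a) 1 (ℤ.<-≤-trans
    (subst (ℤ._< + suc a) (sym (ℤ.*-identityʳ (+ a))) (ℤ.+<+ (ℕ.n<1+n a)))
    (ℤ.≤-trans (ℤ.+≤+ (ℕ.m≤m*n (suc a) (suc d))) (ℤ.≤-reflexive (ℤ.pos-* (suc a) (suc d)))))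
  archimedean q@(mkℚ -[1+ a ] d _) = 1 , </⇐ (+ 1) 1
    (subst (ℤ._< + 1 ℤ.* + suc d) (sym (ℤ.*-identityʳ -[1+ a ])) ℤ.-<+)

  grid : ℚ → ℚ → ℕ → ℚ
  grid a δ zero    = a
  grid a δ (suc i) = grid a δ i + δ

  grid-closed : ∀ a δ i → grid a δ i ≡ a + + i / 1 * δ
  grid-closed a δ zero = sym (trans (cong (λ z → a + z) (ℚ.*-zeroˡ δ)) (ℚ.+-identityʳ a))
  grid-closed a δ (suc i) = trans (cong (_+ δ) (grid-closed a δ i))
    (trans (lemma a δ (+ i / 1)) (cong (λ z → a + z * δ) (sym (suc-/1 i))))
    where
    lemma : ∀ a δ x → a + x * δ + δ ≡ a + (1ℚ + x) * δ
    lemma = solve 3 (λ a δ x → a :+ x :* δ :+ δ := a :+ (con 1ℚ :+ x) :* δ) refl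

  grid-unbounded : ∀ a δ → 0ℚ < δ → ∀ b → ∃[ i ] b < grid a δ i
  grid-unbounded a δ 0<δ b = let i , lt = archimedean ((b - a) * 1/ δ) in i , (begin-strict
    b                         ≡⟨ lemma a b ⟩
    a + (b - a) * 1ℚ          ≡⟨ cong (λ z → a + (b - a) * z) (ℚ.*-inverseˡ δ) ⟨
    a + (b - a) * (1/ δ * δ)  ≡⟨ cong (λ z → a + z) (ℚ.*-assoc (b - a) (1/ δ) δ) ⟨
    a + (b - a) * 1/ δ * δ    <⟨ ℚ.+-monoʳ-< a (ℚ.*-monoˡ-<-pos δ lt) ⟩
    a + + i / 1 * δ           ≡⟨ grid-closed a δ i ⟨
    grid a δ i                ∎)
    where
    instance δ>0 : Positive δ
             δ>0 = ℚ.positive 0<δ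
             δ≢0 : ℚ.NonZero δ
             δ≢0 = ℚ.pos⇒nonZero δ
    open ℚ.≤-Reasoning
    lemma : ∀ a b → b ≡ a + (b - a) * 1ℚ
    lemma = solve 2 (λ a b → b := a :+ (b :- a) :* con 1ℚ) refl

  -- Limits of sequences with separated eventual bounds

  module _ (n₀ : ℕ) (u : ∀ n → n₀ ≤ n → ℚ) where

    Eventually : (ℚ → Set) → Set
    Eventually P = ∃[ N ] (∀ n (n₀≤n : n₀ ≤ n) → N ≤ n → P (u n n₀≤n))

    eventually-consistent : ∀ {a b} → Eventually (a <_) → Eventually (_< b) → a < b
    eventually-consistent (M , above) (N , below) =
      ℚ.<-trans (above n n₀≤n (ℕ.≤-trans (ℕ.m≤m⊔n M N) (ℕ.m≤n⊔m n₀ (M ⊔ N))))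
                (below n n₀≤n (ℕ.≤-trans (ℕ.m≤n⊔m M N) (ℕ.m≤n⊔m n₀ (M ⊔ N))))
      where
      n = n₀ ⊔ (M ⊔ N)
      n₀≤n = ℕ.m≤m⊔n n₀ (M ⊔ N)

    module _ {lo hi} (above-lo : Eventually (lo <_)) (below-hi : Eventually (_< hi))
             (separate : ∀ {a b} → a < b → Eventually (a <_) ⊎ Eventually (_< b)) where

      -- The strict gap between `q` and the eventual bound `s` makes the cut rounded: for u n = 1/n,
      -- the bound 0 < u n holds throughout, but no positive rational is an eventual lower bound.
      limit : ℝ
      limit = record
        { Lower = λ q → ∃[ s ] q < s × Eventually (s <_)
        ; Upper = λ q → ∃[ s ] s < q × Eventually (_< s)
        ; lower-inhabited = lo - 1ℚ , lo , below lo , above-lo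
        ; upper-inhabited = hi + 1ℚ , hi , above hi , below-hi
        ; lower-rounded = λ q → mk⇔
            (λ (s , q<s , ev) → let m , q<m , m<s = ℚ.<-dense q<s in m , q<m , s , m<s , ev)
            (λ (s , q<s , s′ , s<s′ , ev) → s′ , ℚ.<-trans q<s s<s′ , ev)
        ; upper-rounded = λ q → mk⇔
            (λ (s , s<q , ev) → let m , s<m , m<q = ℚ.<-dense s<q in m , m<q , s , s<m , ev)
            (λ (s , s<q , s′ , s′<s , ev) → s′ , ℚ.<-trans s′<s s<q , ev)
        ; disjoint = λ { q ((s , q<s , ev) , (s′ , s′<q , ev′)) →
            ℚ.<-asym (ℚ.<-trans s′<q q<s) (eventually-consistent ev ev′) }
        ; located = located }
        where
        above : ∀ q → q < q + 1ℚ
        above q = subst (_< q + 1ℚ) (ℚ.+-identityʳ q) (ℚ.+-monoʳ-< q (ℚ.positive⁻¹ 1ℚ))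
        below : ∀ q → q - 1ℚ < q
        below q = subst (q - 1ℚ <_) (lemma q) (above (q - 1ℚ))
          where
          lemma : ∀ q → q - 1ℚ + 1ℚ ≡ q
          lemma = solve 1 (λ q → q :- con 1ℚ :+ con 1ℚ := q) refl
        located : ∀ q s → q < s → (∃[ t ] q < t × Eventually (t <_)) ⊎ (∃[ t ] t < s × Eventually (_< t))
        located q s q<s with ℚ.<-dense q<s
        -- Two intermediate points are needed, so that a strict gap remains on either side.
        ... | b , q<b , b<s with ℚ.<-dense q<b
        ...   | a , q<a , a<b with separate a<b
        ...     | inj₁ ev = inj₁ (a , q<a , ev)
        ...     | inj₂ ev = inj₂ (b , b<s , ev)

      -- Climbs from `lo` in steps of ε/2. As the grid passes `hi`, the eventual lower bound must
      -- fail to advance somewhere, and there the sequence is caught in an interval of length ε.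
      converges : ConvergesTo n₀ u limit
      converges ε 0<ε = conclude (walk (proj₁ top))
        where
        δ = ½ * ε
        0<δ : 0ℚ < δ
        0<δ = subst (_< δ) (ℚ.*-zeroʳ ½) (ℚ.*-monoʳ-<-pos ½ 0<ε)
        g = grid lo δ
        top = grid-unbounded lo δ 0<δ hi
        step : ∀ q → q < q + δ
        step q = subst (_< q + δ) (ℚ.+-identityʳ q) (ℚ.+-monoʳ-< q 0<δ)
        Bracket = ∃[ i ] Eventually (g i <_) × Eventually (_< g (2 ℕ.+ i))
        walk : ∀ i → Eventually (g i <_) ⊎ Bracket
        walk zero = inj₁ above-lo
        walk (suc i) with walk i
        ... | inj₂ bracket = inj₂ bracket
        -- Separating the next two grid points either advances the lower bound by one step or gives
        -- an upper bound two steps above it.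
        ... | inj₁ ev with separate (step (g (suc i)))
        ...   | inj₁ ev′ = inj₁ ev′
        ...   | inj₂ ev′ = inj₂ (i , ev , ev′)
        cancel : ∀ q ε → q + ½ * ε + ½ * ε - ε ≡ q
        cancel = solve 2 (λ q ε → q :+ con ½ :* ε :+ con ½ :* ε :- ε := q) refl
        double : ∀ q ε → q + ½ * ε + ½ * ε ≡ q + ε
        double = solve 2 (λ q ε → q :+ con ½ :* ε :+ con ½ :* ε := q :+ ε) refl
        conclude : Eventually (g (proj₁ top) <_) ⊎ Bracket →
                   ∃[ N ] (∀ n (n₀≤n : n₀ ≤ n) → N ≤ n →
                     ℝ.Lower limit (u n n₀≤n - ε) × ℝ.Upper limit (u n n₀≤n + ε))
        conclude (inj₁ ev) = contradiction (eventually-consistent ev below-hi) (ℚ.<-asym (proj₂ top))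
        conclude (inj₂ (i , ev@(M , above) , ev′@(N , below))) = M ⊔ N , λ n n₀≤n MN≤n →
            ( g i
            , subst (u n n₀≤n - ε <_) (cancel (g i) ε)
                (ℚ.+-monoˡ-< (- ε) (below n n₀≤n (ℕ.≤-trans (ℕ.m≤n⊔m M N) MN≤n)))
            , ev )
          , ( g (2 ℕ.+ i)
            , subst (_< u n n₀≤n + ε) (sym (double (g i) ε))
                (ℚ.+-monoˡ-< ε (above n n₀≤n (ℕ.≤-trans (ℕ.m≤m⊔n M N) MN≤n)))
            , ev′ )

-- The density of lottery systems

module _ where

  open import Data.Nat using (_+_; _*_; _^_; _∸_; _/_; _%_; _<_)
  open import Data.Nat.Tactic.RingSolver using (solve-∀)

  -- An upper bound of a nonnegative ratio has a natural numerator, which moves the comparison to ℕ.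
  ratio-≤⇒ : ∀ x c .{{_ : NonZero c}} {q} → + x ℚ./ c ℚ.≤ q →
             ∃[ y ] ↥ q ≡ + y × x * ↧ₙ q ≤ y * c
  ratio-≤⇒ x c {mkℚ (+ y) d _} le = y , refl ,
    ℤ.drop‿+≤+ (subst₂ ℤ._≤_ (sym (ℤ.pos-* x (suc d))) (sym (ℤ.pos-* y c)) (/≤⇒ (+ x) c le))
  ratio-≤⇒ x (suc c) {mkℚ -[1+ y ] d _} le
    with () ← subst (ℤ._≤ -[1+ y ] ℤ.* + suc c) (sym (ℤ.pos-* x (suc d))) (/≤⇒ (+ x) (suc c) le)

  ratio-<⇐ : ∀ x c .{{_ : NonZero c}} {q y} → ↥ q ≡ + y → x * ↧ₙ q < y * c → + x ℚ./ c ℚ.< q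
  ratio-<⇐ x c {mkℚ _ d _} {y} refl lt =
    /<⇐ (+ x) c (subst₂ ℤ._<_ (ℤ.pos-* x (suc d)) (ℤ.pos-* y c) (ℤ.+<+ lt))

  <-numerators : ∀ {a b y} → ↥ a ≡ + y → a ℚ.< b → ∃[ z ] ↥ b ≡ + z × y * ↧ₙ b < z * ↧ₙ a
  <-numerators {mkℚ _ c _} {mkℚ (+ z) d _} {y} refl lt = z , refl ,
    ℤ.drop‿+<+ (subst₂ ℤ._<_ (sym (ℤ.pos-* y (suc d))) (sym (ℤ.pos-* z (suc c))) (ℚ.drop-*<* lt))
  <-numerators {mkℚ _ c _} {mkℚ -[1+ z ] d _} {y} refl lt
    with () ← subst (ℤ._< -[1+ z ] ℤ.* + suc c) (sym (ℤ.pos-* y (suc d))) (ℚ.drop-*<* lt)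

  -- Built by `mkℚ` so that numerator and denominator compute.
  integer : ℕ → ℚ
  integer y = mkℚ (+ y) 0 (Coprime.sym (Coprime.1-coprimeTo y))

  -- Convergence from a blow-up inequality, with q in the role of k!

  module _
    (r p q n₀ : ℕ) .{{_ : NonZero q}} (r<n₀ : suc r ≤ n₀)
    (ℓ : ∀ n → n₀ ≤ n → ℕ)
    (C≢0 : ∀ n → n₀ ≤ n → NonZero (n C suc r))
    (blowUp : ∀ {m n} (n₀≤m : n₀ ≤ m) (n₀≤n : n₀ ≤ n) j → n ≤ m * suc (j * q) →
              ℓ n n₀≤n ≤ (ℓ m n₀≤m + p * m ^ r) * suc (j * q) ^ suc r)
    where

    private
      R = suc r

    -- The numbers m (1 + j q) advance by m q, so one of them passes n by a margin bounded in terms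
    -- of m and q.
    dilation : ∀ m n → 1 ≤ m → ∃[ j ] n ≤ m * suc (j * q) × m * suc (j * q) ≤ n + (m + m * q)
    dilation m n 1≤m = j , lower , upper
      where
      instance mq≢0 : NonZero (m * q)
               mq≢0 = ℕ.m*n≢0 m q {{ ℕ.>-nonZero 1≤m }}
      j = suc (n / (m * q))
      open ℕ.≤-Reasoning
      expand : ∀ m q e → m * suc (suc e * q) ≡ m * q + e * (m * q) + m
      expand = solve-∀
      collect : ∀ m q e → m * q + e * (m * q) + m ≡ e * (m * q) + (m + m * q)
      collect = solve-∀
      lower : n ≤ m * suc (j * q)
      lower = begin
        n                                  ≡⟨ ℕ.m≡m%n+[m/n]*n n (m * q) ⟩
        n % (m * q) + n / (m * q) * (m * q)
          ≤⟨ ℕ.+-monoˡ-≤ _ (ℕ.<⇒≤ (ℕ.m%n<n n (m * q))) ⟩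
        m * q + n / (m * q) * (m * q)      ≤⟨ ℕ.m≤m+n _ m ⟩
        m * q + n / (m * q) * (m * q) + m  ≡⟨ expand m q (n / (m * q)) ⟨
        m * suc (j * q)                    ∎
      upper : m * suc (j * q) ≤ n + (m + m * q)
      upper = begin
        m * suc (j * q)                      ≡⟨ expand m q (n / (m * q)) ⟩
        m * q + n / (m * q) * (m * q) + m    ≡⟨ collect m q (n / (m * q)) ⟩
        n / (m * q) * (m * q) + (m + m * q)  ≤⟨ ℕ.+-monoˡ-≤ _ (ℕ.m/n*n≤m n (m * q)) ⟩
        n + (m + m * q)                      ∎

    -- M is independent of α, so that α may be chosen after m (as L(m) itself in ratio-below).
    density-persists : ∀ d → ∃[ M ] (∀ α m (n₀≤m : n₀ ≤ m) → M ≤ m → d * ℓ m n₀≤m ≤ α * (m C R) →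
      ∃[ N ] (∀ n (n₀≤n : n₀ ≤ n) → N ≤ n → d * ℓ n n₀≤n < suc α * (n C R)))
    density-persists d = suc E , λ α m n₀≤m E<m dense → threshold α m , beyond α m n₀≤m E<m dense
      where
      -- The error `p * m ^ r` scaled by `d * R !`. Since `E < m`, it fits into one further unit of
      -- density: α m + E < (α + 1) m.
      E = d * R ! * p
      -- With A = n - R, this is the `R` taken from n plus the overshoot of `dilation`.
      D : ℕ → ℕ
      D m = R + (m + m * q)
      K : ℕ → ℕ
      K m = proj₁ (shifted-power (D m) R)
      threshold : ℕ → ℕ → ℕ
      -- Chosen to give β K < n - R, the source of the strict inequality.
      threshold α m = suc ((α * m + E) * K m) + R
      beyond : ∀ α m (n₀≤m : n₀ ≤ m) → E < m → d * ℓ m n₀≤m ≤ α * (m C R) →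
               ∀ n (n₀≤n : n₀ ≤ n) → threshold α m ≤ n → d * ℓ n n₀≤n < suc α * (n C R)
      beyond α m n₀≤m E<m dense n n₀≤n N≤n =
        -- The multiplier clears three denominators: `A` from `shifted-power`, `m` from β / m, and
        -- `R !` from the binomial bounds.
        ℕ.*-cancelˡ-< (A * (m * R !)) _ _ (begin-strict
          A * (m * R !) * (d * ℓn)           ≡⟨ rearrange₁ A m (R !) d ℓn ⟩
          A * (m * (d * R ! * ℓn))           ≤⟨ ℕ.*-monoʳ-≤ A (ℕ.*-monoʳ-≤ m scaled) ⟩
          A * (m * (β * m ^ r * t ^ R))      ≡⟨ cong (A *_) (rearrange₂ m β (m ^ r) (t ^ R)) ⟩
          A * (β * (m ^ R * t ^ R))          ≡⟨ cong (λ z → A * (β * z)) (*-^-distrib m t R) ⟨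
          A * (β * (m * t) ^ R)              ≤⟨ ℕ.*-monoʳ-≤ A (ℕ.*-monoʳ-≤ β (ℕ.^-monoˡ-≤ R mt≤)) ⟩
          A * (β * (A + D m) ^ R)            ≡⟨ rearrange₃ A β ((A + D m) ^ R) ⟩
          β * (A * (A + D m) ^ R)            ≤⟨ ℕ.*-monoʳ-≤ β (proj₂ (shifted-power (D m) R) A 1≤A) ⟩
          β * (A ^ R * (A + K m))            ≡⟨ rearrange₄ β (A ^ R) A (K m) ⟩
          A ^ R * (β * A + β * K m)
            <⟨ ℕ.*-monoʳ-< (A ^ R) {{ ℕ.m^n≢0 A R {{ ℕ.>-nonZero 1≤A }} }} (ℕ.+-monoʳ-< (β * A) βK<A) ⟩
          A ^ R * (β * A + A)                ≡⟨ cong (A ^ R *_) (ℕ.+-comm (β * A) A) ⟩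
          A ^ R * (suc β * A)
            ≤⟨ ℕ.*-mono-≤ A^R≤ (ℕ.*-monoˡ-≤ A 1+β≤) ⟩
          (n C R) * R ! * (suc α * m * A)    ≡⟨ rearrange₅ (n C R) (R !) (suc α) m A ⟩
          A * (m * R !) * (suc α * (n C R))  ∎)
        where
        open ℕ.≤-Reasoning
        j   = proj₁ (dilation m n (ℕ.≤-trans (s≤s z≤n) E<m))
        t   = suc (j * q)
        A   = n ∸ R
        β   = α * m + E
        ℓn  = ℓ n n₀≤n
        ℓm  = ℓ m n₀≤m
        n≡  : A + R ≡ n
        n≡  = ℕ.m∸n+n≡m (ℕ.≤-trans r<n₀ n₀≤n)
        m≡  : m ∸ R + R ≡ m
        m≡  = ℕ.m∸n+n≡m (ℕ.≤-trans r<n₀ n₀≤m)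
        βK<A : β * K m < A
        βK<A = ℕ.+-cancelʳ-≤ R _ _ (ℕ.≤-trans N≤n (ℕ.≤-reflexive (sym n≡)))
        1≤A : 1 ≤ A
        1≤A = ℕ.≤-trans (s≤s z≤n) βK<A
        n≤mt : n ≤ m * t
        n≤mt = proj₁ (proj₂ (dilation m n (ℕ.≤-trans (s≤s z≤n) E<m)))
        mt≤ : m * t ≤ A + D m
        mt≤ = begin
          m * t                ≤⟨ proj₂ (proj₂ (dilation m n (ℕ.≤-trans (s≤s z≤n) E<m))) ⟩
          n + (m + m * q)      ≡⟨ cong (_+ (m + m * q)) n≡ ⟨
          A + R + (m + m * q)  ≡⟨ ℕ.+-assoc A R (m + m * q) ⟩
          A + D m              ∎
        A^R≤ : A ^ R ≤ (n C R) * R !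
        A^R≤ = subst (λ n → A ^ R ≤ (n C R) * R !) n≡ (C-lower A R)
        C≤m^R : (m C R) * R ! ≤ m ^ R
        C≤m^R = subst (λ m → (m C R) * R ! ≤ m ^ R) m≡ (C-upper (m ∸ R) R)
        1+β≤ : suc β ≤ suc α * m
        1+β≤ = begin
          suc (α * m + E)  ≡⟨ ℕ.+-suc (α * m) E ⟨
          α * m + suc E    ≤⟨ ℕ.+-monoʳ-≤ (α * m) E<m ⟩
          α * m + m        ≡⟨ ℕ.+-comm (α * m) m ⟩
          suc α * m        ∎
        expand : ∀ d f l p m t → d * f * ((l + p * m) * t) ≡ (d * l * f + d * f * p * m) * t
        expand = solve-∀
        collect : ∀ α m y E → α * (m * y) + E * y ≡ (α * m + E) * y
        collect = solve-∀
        scaled : d * R ! * ℓn ≤ β * m ^ r * t ^ R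
        scaled = begin
          d * R ! * ℓn
            ≤⟨ ℕ.*-monoʳ-≤ (d * R !) (blowUp n₀≤m n₀≤n j n≤mt) ⟩
          d * R ! * ((ℓm + p * m ^ r) * t ^ R)   ≡⟨ expand d (R !) ℓm p (m ^ r) (t ^ R) ⟩
          (d * ℓm * R ! + E * m ^ r) * t ^ R
            ≤⟨ ℕ.*-monoˡ-≤ (t ^ R) (ℕ.+-monoˡ-≤ (E * m ^ r) (ℕ.*-monoˡ-≤ (R !) dense)) ⟩
          (α * (m C R) * R ! + E * m ^ r) * t ^ R
            ≡⟨ cong (λ z → (z + E * m ^ r) * t ^ R) (ℕ.*-assoc α (m C R) (R !)) ⟩
          (α * ((m C R) * R !) + E * m ^ r) * t ^ R
            ≤⟨ ℕ.*-monoˡ-≤ (t ^ R) (ℕ.+-monoˡ-≤ (E * m ^ r) (ℕ.*-monoʳ-≤ α C≤m^R)) ⟩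
          (α * (m * m ^ r) + E * m ^ r) * t ^ R  ≡⟨ cong (_* t ^ R) (collect α m (m ^ r) E) ⟩
          β * m ^ r * t ^ R                      ∎
        rearrange₁ : ∀ A m f d l → A * (m * f) * (d * l) ≡ A * (m * (d * f * l))
        rearrange₁ = solve-∀
        rearrange₂ : ∀ m β y z → m * (β * y * z) ≡ β * (m * y * z)
        rearrange₂ = solve-∀
        rearrange₃ : ∀ A β z → A * (β * z) ≡ β * (A * z)
        rearrange₃ = solve-∀
        rearrange₄ : ∀ β y A K → β * (y * (A + K)) ≡ y * (β * A + β * K)
        rearrange₄ = solve-∀
        rearrange₅ : ∀ c f a m A → c * f * (a * m * A) ≡ A * (m * f) * (a * c)
        rearrange₅ = solve-∀

    private
      u : ∀ n → n₀ ≤ n → ℚ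
      u n n₀≤n = ℚ._/_ (+ ℓ n n₀≤n) (n C R) {{ C≢0 n n₀≤n }}

      M : ℕ → ℕ
      M d = proj₁ (density-persists d)

      persists : ∀ d α m (n₀≤m : n₀ ≤ m) → M d ≤ m → d * ℓ m n₀≤m ≤ α * (m C R) →
        ∃[ N ] (∀ n (n₀≤n : n₀ ≤ n) → N ≤ n → d * ℓ n n₀≤n < suc α * (n C R))
      persists d = proj₂ (density-persists d)

    ratio-above : Eventually n₀ u (ℚ.- 1ℚ ℚ.<_)
    ratio-above = 0 , λ n n₀≤n _ → ℚ.<-≤-trans (ℚ.negative⁻¹ (ℚ.- 1ℚ))
      (ℚ.nonNegative⁻¹ (u n n₀≤n) {{ ℚ.normalize-nonNeg (ℓ n n₀≤n) (n C R) {{ C≢0 n n₀≤n }} }})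

    -- Boundedness uses d = 1 and α = L(m), an admissible density because the binomial coefficient
    -- is at least 1.
    ratio-below : ∃[ b ] Eventually n₀ u (ℚ._< b)
    ratio-below =
      let m         = n₀ ⊔ M 1
          n₀≤m      = ℕ.m≤m⊔n n₀ (M 1)
          α         = ℓ m n₀≤m
          N , small = persists 1 α m n₀≤m (ℕ.m≤n⊔m n₀ (M 1))
            (subst (_≤ α * (m C R)) (sym (ℕ.*-identityˡ α)) (ℕ.m≤m*n α (m C R) {{ C≢0 m n₀≤m }}))
      in  integer (suc α) , N , λ n n₀≤n N≤n →
            ratio-<⇐ (ℓ n n₀≤n) (n C R) {{ C≢0 n n₀≤n }} {integer (suc α)} refl
              (subst (_< suc α * (n C R)) (ℕ.*-comm 1 (ℓ n n₀≤n)) (small n n₀≤n N≤n))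

    module _ (em : ExcludedMiddle 0ℓ) where

      -- Either the ratio exceeds a from `M` on, or it is at most a at one index m from `M` on, and
      -- persistence of density keeps it below b eventually. Excluded middle decides between the
      -- two.
      ratio-separate : ∀ {a b} → a ℚ.< b → Eventually n₀ u (a ℚ.<_) ⊎ Eventually n₀ u (ℚ._< b)
      ratio-separate {a} {b} a<b
        with em {∃[ m ] ∃ λ (n₀≤m : n₀ ≤ m) → M (↧ₙ a * ↧ₙ b) ≤ m × u m n₀≤m ℚ.≤ a}
      ... | no  none = inj₁ (M (↧ₙ a * ↧ₙ b) , λ n n₀≤n M≤n →
              ℚ.≰⇒> λ un≤a → none (n , n₀≤n , M≤n , un≤a))
      ... | yes (m , n₀≤m , M≤m , um≤a) =
        let y , ↥a≡ , dense = ratio-≤⇒ (ℓ m n₀≤m) (m C R) {{ C≢0 m n₀≤m }} {a} um≤a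
            z , ↥b≡ , y<z   = <-numerators {a} {b} ↥a≡ a<b
            -- Over the common denominator d the numerators of a and b are integers α < β, so
            -- `suc α` is still at most the numerator of b.
            N , small       = persists (↧ₙ a * ↧ₙ b) (y * ↧ₙ b) m n₀≤m M≤m
              (subst₂ _≤_ (swap₁ (ℓ m n₀≤m) (↧ₙ a) (↧ₙ b)) (swap₂ y (m C R) (↧ₙ b)) (ℕ.*-monoˡ-≤ (↧ₙ b) dense))
        in  inj₂ (N , λ n n₀≤n N≤n → ratio-<⇐ (ℓ n n₀≤n) (n C R) {{ C≢0 n n₀≤n }} {b} ↥b≡
              (ℕ.*-cancelˡ-< (↧ₙ a) _ _ (subst₂ _<_ (swap₃ (↧ₙ a) (↧ₙ b) (ℓ n n₀≤n)) (swap₄ z (↧ₙ a) (n C R))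
                (ℕ.<-≤-trans (small n n₀≤n N≤n) (ℕ.*-monoˡ-≤ (n C R) y<z)))))
        where
        swap₁ : ∀ l a b → l * a * b ≡ a * b * l
        swap₁ = solve-∀
        swap₂ : ∀ y c b → y * c * b ≡ y * b * c
        swap₂ = solve-∀
        swap₃ : ∀ a b l → a * b * l ≡ a * (l * b)
        swap₃ = solve-∀
        swap₄ : ∀ z a c → z * a * c ≡ a * (z * c)
        swap₄ = solve-∀

      ratio-converges : ∃[ l ] ConvergesTo n₀ u l
      ratio-converges =
          limit n₀ u ratio-above (proj₂ ratio-below) ratio-separate
        , converges n₀ u ratio-above (proj₂ ratio-below) ratio-separate

mainTheorem2 : ExcludedMiddle 0ℓ →
    ∀ (k r p : ℕ) → 1 ≤ r → (r≤k : r ≤ k) → (r≤p : r ≤ p) →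
    ∃[ l ] ConvergesTo (k ⊔ p) (lotteryRatio k r p r≤k r≤p) l
mainTheorem2 em k (suc r) p _ r≤k r≤p =
  ratio-converges r p (k !) (k ⊔ p) {{ k ℕ.!≢0 }} r<n₀
    (λ n → L n k (suc r) p r≤k r≤p)
    (λ n n₀≤n → nCr-nonZero n (suc r) (ℕ.≤-trans r<n₀ n₀≤n))
    (L-blowUp em r≤k r≤p) em
  where
  r<n₀ : suc r ≤ k ⊔ p
  r<n₀ = ℕ.≤-trans r≤k (ℕ.m≤m⊔n k p)
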